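{- Let $s\ge 1$ be an integer and let $T$ be a tree with maximum degree $\Delta(T)\ge 2$. Then $$br_{\Delta}(T;s)\le 2s(\Delta(T)-1).$$
   Context: For graphs $H$ and $G$ and a positive integer $s$, write $H\xrightarrow{s} G$ if every coloring of the edges of $H$ with $s$ colors contains a monochromatic subgraph isomorphic to $G$. The degree bipartite Ramsey number is $br_{\Delta}(G;s)=\min\{\Delta(H): H \text{ is bipartite and } H\xrightarrow{s} G\}$, where $\Delta(H)$ denotes the maximum degree of $H$. -}

module Defs where

open import Data.Bool.Base using (Bool)
open import Data.Fin.Base using (Fin; zero; suc; fromℕ; inject₁)
open import Data.List.Base using (allFin; filter; length; map)
open import Data.List.Extrema.Nat using (max)
open import Data.Nat.Base using (ℕ; _+_; _≤_)
open import Data.Product.Base using (Σ; ∃-syntax; _×_)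
open import Function.Definitions using (Injective)
open import Level using (0ℓ)
open import Relation.Binary.Construct.Closure.ReflexiveTransitive using (Star)
open import Relation.Binary.Core using (Rel)
open import Relation.Binary.Definitions using (Decidable; Irreflexive; Symmetric)
open import Relation.Binary.PropositionalEquality.Core using (_≡_; _≢_)
open import Relation.Nullary.Negation.Core using (¬_)

-- Finite simple graphs.
record Graph : Set₁ where
  field
    order  : ℕ
    Adj    : Rel (Fin order) 0ℓ
    adj?   : Decidable Adj
    sym    : Symmetric Adj
    irrefl : Irreflexive _≡_ Adj

  Vertex : Set
  Vertex = Fin order

  degree : Vertex → ℕ
  degree v = length (filter (adj? v) (allFin order))

open Graph public using (Vertex)

Δ : Graph → ℕ
Δ G = max 0 (map degree (allFin order))
  where open Graph G

Bipartite : Graph → Set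
Bipartite G = Σ (Vertex G → Bool) λ side →
  ∀ {u v} → Graph.Adj G u v → side u ≢ side v

-- The empty graph does not count as connected.
Connected : Graph → Set
Connected G = Vertex G × (∀ u v → Star (Graph.Adj G) u v)

-- A cycle has 3 + k vertices, so backtracking along an edge is not a cycle.
record Cycle (G : Graph) : Set where
  open Graph G using (Adj)
  field
    k         : ℕ
    vertex    : Fin (3 + k) → Vertex G
    injective : Injective _≡_ _≡_ vertex
    step      : ∀ i → Adj (vertex (inject₁ i)) (vertex (suc i))
    close     : Adj (vertex (fromℕ _)) (vertex zero)

Acyclic : Graph → Set
Acyclic G = ¬ Cycle G

IsTree : Graph → Set
IsTree G = Connected G × Acyclic G

-- The symmetry law, stated for arbitrary proofs of adjacency, makes the colour
-- a function of the unordered pair {u , v} alone.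
record EdgeColouring (H : Graph) (s : ℕ) : Set where
  open Graph H using (Adj)
  field
    colour     : ∀ {u v} → Adj u v → Fin s
    colour-sym : ∀ {u v} (e : Adj u v) (e′ : Adj v u) → colour e ≡ colour e′

-- A subgraph of H isomorphic to G (not necessarily induced), given by its
-- embedding, all of whose edges have the same colour.
record MonochromaticCopy (G H : Graph) {s : ℕ} (χ : EdgeColouring H s) : Set where
  private
    module G = Graph G
    module H = Graph H
  open EdgeColouring χ using (colour)
  field
    embed     : Vertex G → Vertex H
    injective : Injective _≡_ _≡_ embed
    edge      : ∀ {u v} → G.Adj u v → H.Adj (embed u) (embed v)
    shade     : Fin s
    mono      : ∀ {u v} (e : G.Adj u v) → colour (edge e) ≡ shade

infix 4 _⟶[_]_

_⟶[_]_ : Graph → ℕ → Graph → Set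
H ⟶[ s ] G = (χ : EdgeColouring H s) → MonochromaticCopy G H χ

IsMinimum : ∀ {ℓ} → (ℕ → Set ℓ) → ℕ → Set ℓ
IsMinimum P m = P m × (∀ n → P n → m ≤ n)

BipartiteRamseyDegree : Graph → ℕ → ℕ → Set₁
BipartiteRamseyDegree G s d = ∃[ H ] Bipartite H × H ⟶[ s ] G × Δ H ≡ d

-- "d = br_Δ(G; s)".  This is a relation rather than a function because the
-- minimum ranges over all bipartite graphs: membership in the set being
-- minimised is not known to be decidable, so an inhabited such set has a least
-- element only up to double negation.
IsBrΔ : Graph → ℕ → ℕ → Set₁
IsBrΔ G s = IsMinimum (BipartiteRamseyDegree G s)

{-# OPTIONS --safe #-}

-- Put m = Δ(T) − 1 and let H be a 2sm-regular bipartite graph with more than |T|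
-- vertices on each cycle.  It has sm|V(H)| edges, so some colour class has at
-- least m|V(H)| of them.  Deleting vertices of degree at most m as long as there
-- are any preserves this edge density, and hence ends at a nonempty subgraph of
-- minimum degree at least m + 1 = Δ(T).  There T is embedded leaf by leaf: the
-- image p of the parent has a neighbour that is not the image of a sibling, and
-- if it were the image of any other vertex then the path from there to p would
-- close a short cycle.
--
-- H is obtained from 2sm parallel edges by iterated (ℤ/2)^E-lifts, each of which
-- increases the girth.
module Submission where

open import Data.Bool.Base using (Bool; true; false; not; if_then_else_)
import Data.Bool.Properties as Bool
open import Data.Fin.Base using (Fin; zero; suc; fromℕ; inject₁; combine; remQuot; opposite; finToFun; funToFin)
open import Data.Fin.Properties
  using (_≟_; combine-injective; combine-remQuot; remQuot-combine; finToFun-funToFin;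
         funToFin-finToFin; opposite-involutive; injective⇒≤)
import Data.Fin.Properties as Fin
open import Data.List.Base
  using (List; []; _∷_; _++_; _∷ʳ_; length; filter; map; allFin; lookup; cartesianProduct)
open import Data.List.Extrema.Nat using (xs≤max; max≤v⁺)
import Data.List.Membership.DecPropositional as DecMembership
open import Data.List.Membership.Propositional using (_∈_; _∉_; find)
open import Data.List.Membership.Propositional.Properties
  using (∈-lookup; ∈-allFin; ∈-filter⁺; ∈-filter⁻; ∈-map⁺; ∈-map⁻; ∈-++⁻; ∈-cartesianProduct⁻)
open import Data.List.Membership.Setoid.Properties using (index-injective)
open import Data.List.Properties using (filter-notAll; length-++; length-map; length-tabulate)
open import Data.List.Relation.Binary.Sublist.Propositional.Properties
  using (length-mono-≤; filter⁺; filter-⊆)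
open import Data.List.Relation.Binary.Subset.Propositional using (_⊆_)
open import Data.List.Relation.Unary.All using ([]; _∷_)
import Data.List.Relation.Unary.All as All
import Data.List.Relation.Unary.All.Properties as All
open import Data.List.Relation.Unary.AllPairs using ([]; _∷_)
open import Data.List.Relation.Unary.Any using (any?; here; there; index)
import Data.List.Relation.Unary.Any as Any
open import Data.List.Relation.Unary.Linked using (Linked; []; [-]; _∷_)
import Data.List.Relation.Unary.Linked as Linked
open import Data.List.Relation.Unary.Unique.Propositional using (Unique)
import Data.List.Relation.Unary.Unique.Propositional.Properties as Unique
open import Data.Nat.Base
  using (ℕ; zero; suc; _+_; _*_; _∸_; _^_; _≤_; _<_; z≤n; s≤s; >-nonZero)
open import Data.Nat.Induction using (<-rec)
open import Data.Nat.Properties hiding (_≟_)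
open import Data.Nat.Solver using (module +-*-Solver)
open import Data.Product.Base using (Σ; ∃-syntax; _×_; _,_; proj₁; proj₂)
open import Data.Product.Properties using (,-injective; ≡-dec)
open import Data.Sum.Base using (_⊎_; inj₁; inj₂; swap)
open import Data.Vec.Functional using (updateAt)
open import Data.Vec.Functional.Properties using (updateAt-updates; updateAt-minimal)
open import Level using (0ℓ)
open import Relation.Binary.Construct.Closure.ReflexiveTransitive using (Star; ε; _◅_)
open import Relation.Binary.Core using (Rel)
open import Relation.Binary.Definitions using (DecidableEquality; Symmetric)
open import Relation.Binary.PropositionalEquality
open import Relation.Nullary using (Dec; yes; no; contradiction; ¬?)
open import Relation.Nullary.Decidable using (_⊎-dec_; decidable-stable)
open import Relation.Nullary.Negation.Core using (¬_)
open import Relation.Unary using (Pred; Decidable)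

open import Defs

private variable
  A B : Set

-- Lists without repetitions.

lookup-injective : {xs : List A} → Unique xs → ∀ i j → lookup xs i ≡ lookup xs j → i ≡ j
lookup-injective (_   ∷ _)      zero    zero    _  = refl
lookup-injective (x∉ ∷ _)      zero    (suc j) eq = contradiction eq (All.lookup x∉ (∈-lookup j))
lookup-injective (x∉ ∷ _)      (suc i) zero    eq = contradiction (sym eq) (All.lookup x∉ (∈-lookup i))
lookup-injective (_   ∷ unique) (suc i) (suc j) eq = cong suc (lookup-injective unique i j eq)

length-mono-⊆ : {xs ys : List A} → Unique xs → xs ⊆ ys → length xs ≤ length ys
length-mono-⊆ {A} {xs} {ys} unique xs⊆ys =
  injective⇒≤ {f = λ i → index (xs⊆ys (∈-lookup i))} λ eq →
    lookup-injective unique _ _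
      (index-injective (setoid A) (xs⊆ys (∈-lookup _)) (xs⊆ys (∈-lookup _)) eq)

-- Paths, short cycles and edge-labelled bipartite graphs.

data Path (R : Rel A 0ℓ) : A → A → List A → Set where
  stop : ∀ v → Path R v v (v ∷ [])
  step : ∀ {u x v xs} → R u x → u ∉ xs → Path R x v xs → Path R u v (u ∷ xs)

source∈ : ∀ {R : Rel A 0ℓ} {u v xs} → Path R u v xs → u ∈ xs
source∈ (stop _)     = here refl
source∈ (step _ _ _) = here refl

-- The cycle u, x, …, v has 1 + length xs vertices; x ≢ v excludes the walk
-- back and forth along an edge.
NoCycleUpTo : ℕ → Rel A 0ℓ → Set
NoCycleUpTo n R = ∀ {u x v xs} → R u x → u ∉ xs → Path R x v xs → x ≢ v → R v u →
                  ¬ length xs < n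

-- A `D`-regular bipartite multigraph with properly labelled edges: each label is a perfect
-- matching, given as an involution. Different labels may yield parallel edges.
record LabelledGraph (D : ℕ) : Set where
  field
    order           : ℕ
    move            : Fin D → Fin order → Fin order
    move-involutive : ∀ i v → move i (move i v) ≡ v
    side            : Fin order → Bool
    side-move       : ∀ i v → side (move i v) ≡ not (side v)

  walk : Fin order → List (Fin D) → Fin order
  walk v []      = v
  walk v (i ∷ w) = walk (move i v) w

  Adjacent : Rel (Fin order) 0ℓ
  Adjacent u v = ∃[ i ] move i u ≡ v

  Adjacent-sym : ∀ {u v} → Adjacent u v → Adjacent v u
  Adjacent-sym (i , refl) = i , move-involutive i _

  -- As labels are involutions, a word without equal consecutive letters is a walk that never
  -- backtracks. Here `i ∷ w` has at most `n` letters.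
  NoClosedWordUpTo : ℕ → Set
  NoClosedWordUpTo n = ∀ v i w → Linked _≢_ (i ∷ w) → length w < n → walk v (i ∷ w) ≢ v

  -- `j` leads from `x` back to the vertex before the path. That vertex is not on the path, so the
  -- first label of the path differs from `j`.
  pathWord : ∀ {x v xs} j → move j x ∉ xs → Path Adjacent x v xs →
             ∃[ w ] Linked _≢_ (j ∷ w) × walk x w ≡ v × suc (length w) ≡ length xs
  pathWord j _ (stop _) = [] , [-] , refl , refl
  pathWord {x} j prev∉ (step (k , refl) x∉ p)
    with w , reduced , end , len ←
           pathWord k (λ x∈ → x∉ (subst (_∈ _) (move-involutive k x) x∈)) p
    = k ∷ w , (λ { refl → prev∉ (there (source∈ p)) }) ∷ reduced , end , cong suc len

  noCycleUpTo : ∀ {n} → NoClosedWordUpTo n → NoCycleUpTo n Adjacent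
  noCycleUpTo {n} girth {u} {x} {v} (k , refl) u∉ p x≢v (i , refl) len<
    with w , reduced , end , len ←
           pathWord k (λ x∈ → u∉ (subst (_∈ _) (move-involutive k u) x∈)) p
    -- The cycle is read from `v`: over the closing edge to `u`, then to `x` and along the path. If
    -- `i` were `k`, then `x` would be `v`.
    = girth v i (k ∷ w) ((λ { refl → x≢v (move-involutive i v) }) ∷ reduced)
            (subst (_< n) (sym len) len<) end

  -- Parallel edges would form a closed word of length two.
  move-injectiveˡ : ∀ {n} → NoClosedWordUpTo (2 + n) → ∀ {i j v} → move i v ≡ move j v → i ≡ j
  move-injectiveˡ girth {i} {j} {v} eq with i ≟ j
  ... | yes i≡j = i≡j
  ... | no  i≢j = contradiction (trans (cong (move j) eq) (move-involutive j v))
                                (girth v i (j ∷ []) (i≢j ∷ [-]) (s≤s (s≤s z≤n)))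

-- Lifts of larger girth.

Linked-++⁻ˡ : ∀ {R : Rel A 0ℓ} xs {ys} → Linked R (xs ++ ys) → Linked R xs
Linked-++⁻ˡ []           _       = []
Linked-++⁻ˡ (_ ∷ [])     _       = [-]
Linked-++⁻ˡ (_ ∷ y ∷ xs) (r ∷ l) = r ∷ Linked-++⁻ˡ (y ∷ xs) l

-- An element of Fin (2 ^ m) as a vector of m bits.
module _ {m : ℕ} where

  bit : Fin m → Fin (2 ^ m) → Fin 2
  bit e x = finToFun x e

  flip : Fin m → Fin (2 ^ m) → Fin (2 ^ m)
  flip e x = funToFin (updateAt (finToFun x) e opposite)

  bit-flip : ∀ e x → bit e (flip e x) ≡ opposite (bit e x)
  bit-flip e x = trans (finToFun-funToFin _ e) (updateAt-updates e (finToFun x))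

  bit-flip-≢ : ∀ {e d} x → e ≢ d → bit e (flip d x) ≡ bit e x
  bit-flip-≢ {e} {d} x e≢d =
    trans (finToFun-funToFin _ e) (updateAt-minimal e d (finToFun x) e≢d)

  flip-involutive : ∀ e x → flip e (flip e x) ≡ x
  flip-involutive e x = trans (funToFin-cong bits) (funToFin-finToFin {m} {2} x)
    where
    funToFin-cong : ∀ {k l} {f g : Fin k → Fin l} → (∀ i → f i ≡ g i) → funToFin f ≡ funToFin g
    funToFin-cong {zero}  eq = refl
    funToFin-cong {suc k} eq = cong₂ combine (eq zero) (funToFin-cong (λ i → eq (suc i)))

    bits : ∀ d → updateAt (finToFun (flip e x)) e opposite d ≡ finToFun x d
    bits d with d ≟ e
    ... | yes refl = trans (updateAt-updates e (finToFun (flip e x)))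
                           (trans (cong opposite (bit-flip e x)) (opposite-involutive _))
    ... | no  d≢e  = trans (updateAt-minimal d e (finToFun (flip e x)) d≢e) (bit-flip-≢ x d≢e)

opposite≢ : (b : Fin 2) → opposite b ≢ b
opposite≢ zero       ()
opposite≢ (suc zero) ()

-- The lift of G by the group (ℤ/2)^E, where crossing an edge flips its own
-- coordinate.  A closed walk in the lift crosses every edge an even number of
-- times, so it projects to a closed walk of G that is not as short as possible.
module Lift {D : ℕ} (G : LabelledGraph D) where
  open LabelledGraph G

  edges : ℕ
  edges = order * D

  -- Naming an edge by its label and its end on the `false` side gives both directions of crossing
  -- the same coordinate.
  leftEnd : Fin D → Fin order → Fin order
  leftEnd i v = if side v then move i v else v

  edge : Fin D → Fin order → Fin edges
  edge i v = combine (leftEnd i v) i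

  leftEnd-move : ∀ i v → leftEnd i (move i v) ≡ leftEnd i v
  leftEnd-move i v with side v | side (move i v) | side-move i v
  ... | true  | _ | refl = refl
  ... | false | _ | refl = move-involutive i v

  leftEnd-injective : ∀ i {u v} → leftEnd i u ≡ leftEnd i v → u ≡ v ⊎ u ≡ move i v
  leftEnd-injective i {u} {v} eq with side u | side v
  ... | true  | true  = inj₁ (trans (sym (move-involutive i u))
                                    (trans (cong (move i) eq) (move-involutive i v)))
  ... | true  | false = inj₂ (trans (sym (move-involutive i u)) (cong (move i) eq))
  ... | false | true  = inj₂ eq
  ... | false | false = inj₁ eq

  order′ : ℕ
  order′ = order * 2 ^ edges

  base : Fin order′ → Fin order
  base z = proj₁ (remQuot {order} (2 ^ edges) z)

  bits : Fin order′ → Fin (2 ^ edges)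
  bits z = proj₂ (remQuot {order} (2 ^ edges) z)

  move′ : Fin D → Fin order′ → Fin order′
  move′ i z = combine (move i (base z)) (flip (edge i (base z)) (bits z))

  base-move′ : ∀ i z → base (move′ i z) ≡ move i (base z)
  base-move′ i z = cong proj₁ (remQuot-combine (move i (base z)) (flip (edge i (base z)) (bits z)))

  bits-move′ : ∀ i z → bits (move′ i z) ≡ flip (edge i (base z)) (bits z)
  bits-move′ i z = cong proj₂ (remQuot-combine (move i (base z)) (flip (edge i (base z)) (bits z)))

  edge-base-move′ : ∀ i z → edge i (base (move′ i z)) ≡ edge i (base z)
  edge-base-move′ i z =
    trans (cong (edge i) (base-move′ i z)) (cong (λ v → combine v i) (leftEnd-move i (base z)))

  move′-involutive : ∀ i z → move′ i (move′ i z) ≡ z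
  move′-involutive i z = begin
    move′ i (move′ i z)
      ≡⟨ cong₂ combine
           (trans (cong (move i) (base-move′ i z)) (move-involutive i (base z)))
           (trans (cong₂ flip (edge-base-move′ i z) (bits-move′ i z)) (flip-involutive (edge i (base z)) (bits z))) ⟩
    combine (base z) (bits z)
      ≡⟨ combine-remQuot {order} (2 ^ edges) z ⟩
    z ∎
    where open ≡-Reasoning

  lift : LabelledGraph D
  lift = record
    { order           = order′
    ; move            = move′
    ; move-involutive = move′-involutive
    ; side            = λ z → side (base z)
    ; side-move       = λ i z → trans (cong side (base-move′ i z)) (side-move i (base z))
    }

  private module L = LabelledGraph lift

  base-walk : ∀ z w → base (L.walk z w) ≡ walk (base z) w
  base-walk z []      = refl
  base-walk z (i ∷ w) = trans (base-walk (move′ i z) w) (cong (λ v → walk v w) (base-move′ i z))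

  -- Only a crossing of `e` changes its bit. The hypothesis runs over splittings of `w` because the
  -- edge crossed by `j` depends on where `w₁` leads.
  bit-walk : ∀ e z w → (∀ w₁ {j w₂} → w ≡ w₁ ++ j ∷ w₂ → e ≢ edge j (walk (base z) w₁)) →
             bit e (bits (L.walk z w)) ≡ bit e (bits z)
  bit-walk e z []      avoids = refl
  bit-walk e z (i ∷ w) avoids = begin
    bit e (bits (L.walk (move′ i z) w))
      ≡⟨ bit-walk e (move′ i z) w (λ w₁ {j} eq →
           subst (λ v → e ≢ edge j (walk v w₁)) (sym (base-move′ i z))
                 (avoids (i ∷ w₁) (cong (i ∷_) eq))) ⟩
    bit e (bits (move′ i z))
      ≡⟨ cong (bit e) (bits-move′ i z) ⟩
    bit e (flip (edge i (base z)) (bits z))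
      ≡⟨ bit-flip-≢ (bits z) (avoids [] refl) ⟩
    bit e (bits z) ∎
    where open ≡-Reasoning

  -- A closed walk restores the bit of its first edge `e`, so it crosses `e` again; this yields a
  -- closed reduced word of at most `n` letters in `G`.
  girth-lift : ∀ {n} → NoClosedWordUpTo n → L.NoClosedWordUpTo (suc n)
  girth-lift {n} girth z i w reduced (s≤s len≤) closed =
    opposite≢ (bit e (bits z)) (begin
      opposite (bit e (bits z))     ≡⟨ bit-flip e (bits z) ⟨
      bit e (flip e (bits z))       ≡⟨ cong (bit e) (bits-move′ i z) ⟨
      bit e (bits (move′ i z))      ≡⟨ bit-walk e (move′ i z) w avoids ⟨
      bit e (bits (L.walk z (i ∷ w))) ≡⟨ cong (λ y → bit e (bits y)) closed ⟩
      bit e (bits z)                ∎)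
    where
    open ≡-Reasoning
    v = base z
    e = edge i v

    -- The second crossing of e, in either direction, closes a shorter word.
    again : ∀ w₁ {w₂} → w ≡ w₁ ++ i ∷ w₂ →
            ¬ (v ≡ walk (move i v) w₁ ⊎ v ≡ move i (walk (move i v) w₁))
    -- Same direction: the walk is back at `v` before the second crossing, so `i ∷ w₁` is closed.
    again w₁ {w₂} refl (inj₁ eq) =
      girth v i w₁ (Linked-++⁻ˡ (i ∷ w₁) reduced) shorter (sym eq)
      where
      shorter : length w₁ < n
      shorter = ≤-trans (≤-trans (s≤s (m≤m+n _ (length w₂))) (≤-reflexive
        (sym (trans (length-++ w₁) (+-suc (length w₁) (length w₂)))))) len≤
    -- Opposite direction with nothing in between: two consecutive letters `i`, contrary to
    -- reducedness.
    again [] refl (inj₂ _) = Linked.head reduced refl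
    -- Otherwise the letters between the two crossings form a closed word at `move i v`.
    again (j ∷ w₁) {w₂} refl (inj₂ eq) =
      girth (move i v) j w₁ (Linked-++⁻ˡ (j ∷ w₁) (Linked.tail reduced))
        (≤-trans (s≤s (≤-trans (m≤m+n _ (length (i ∷ w₂))) (≤-reflexive (sym (length-++ w₁))))) len≤)
        (trans (sym (move-involutive i _)) (cong (move i) (sym eq)))

    avoids : ∀ w₁ {j w₂} → w ≡ w₁ ++ j ∷ w₂ → e ≢ edge j (walk (base (move′ i z)) w₁)
    avoids w₁ {j} eq same
      rewrite base-move′ i z
      with ends , refl ← combine-injective (leftEnd i v) i (leftEnd j (walk (move i v) w₁)) j same
      = again w₁ eq (leftEnd-injective i ends)

parallel : ∀ D → LabelledGraph D
parallel D = record
  { order           = 2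
  ; move            = λ _ → opposite
  ; move-involutive = λ _ → opposite-involutive
  ; side            = λ { zero → false ; (suc _) → true }
  ; side-move       = λ { _ zero → refl ; _ (suc zero) → refl }
  }

-- For the parallel edges the bound 0 is vacuous, and each lift raises it by one. The vertex records
-- that the graph is nonempty.
highGirth : ∀ D n → Σ (LabelledGraph D) λ G → LabelledGraph.NoClosedWordUpTo G n × Fin (LabelledGraph.order G)
highGirth D zero = parallel D , (λ _ _ _ _ ()) , zero
highGirth D (suc n) with G , girth , v ← highGirth D n =
  Lift.lift G , Lift.girth-lift G girth , combine v (funToFin {Lift.edges G} {2} (λ _ → zero))

-- Counting and the pigeonhole principle.

length-partition : {P : Pred A 0ℓ} (P? : Decidable P) (xs : List A) →
                   length (filter P? xs) + length (filter (λ x → ¬? (P? x)) xs) ≡ length xs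
length-partition P? []       = refl
length-partition P? (x ∷ xs) with P? x
... | yes _ = cong suc (length-partition P? xs)
... | no  _ = trans (+-suc _ _) (cong suc (length-partition P? xs))

length-cartesianProduct : (xs : List A) (ys : List B) →
                          length (cartesianProduct xs ys) ≡ length xs * length ys
length-cartesianProduct []       ys = refl
length-cartesianProduct (x ∷ xs) ys =
  trans (length-++ (map (x ,_) ys))
        (cong₂ _+_ (length-map (x ,_) ys) (length-cartesianProduct xs ys))

-- If the class of the first colour has at most `q` members, discarding it keeps the inequality for
-- the remaining colours.
pigeonhole : (_≟_ : DecidableEquality B) (f : A → B) (q : ℕ) (cs : List B) (xs : List A) →
             (∀ {x} → x ∈ xs → f x ∈ cs) → length cs * q < length xs →
             ∃[ c ] q < length (filter (λ x → f x ≟ c) xs)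
pigeonhole _≟_ f q []       (x ∷ xs) f∈ _ with () ← f∈ (here refl)
pigeonhole _≟_ f q (c ∷ cs) xs f∈ large
  with q <? length (filter (λ x → f x ≟ c) xs)
... | yes q< = c , q<
... | no  q≮ =
  let c′ , q< = pigeonhole _≟_ f q cs others others∈ fewer in
  c′ , ≤-trans q< (length-mono-≤ (filter⁺ (λ x → f x ≟ c′) (λ x → f x ≟ c′)
                    (λ { refl p → p }) (filter-⊆ (λ x → ¬? (f x ≟ c)) xs)))
  where
  others = filter (λ x → ¬? (f x ≟ c)) xs

  others∈ : ∀ {x} → x ∈ others → f x ∈ cs
  others∈ x∈ with ∈-filter⁻ (λ x → ¬? (f x ≟ c)) {xs = xs} x∈
  ... | x∈xs , fx≢c with f∈ x∈xs
  ...   | here fx≡c = contradiction fx≡c fx≢c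
  ...   | there fx∈ = fx∈

  fewer : length cs * q < length others
  fewer = +-cancelˡ-< q _ _ (begin-strict
    q + length cs * q                                  <⟨ large ⟩
    length xs                                          ≡⟨ length-partition (λ x → f x ≟ c) xs ⟨
    length (filter (λ x → f x ≟ c) xs) + length others ≤⟨ +-monoˡ-≤ _ (≮⇒≥ q≮) ⟩
    q + length others                                  ∎)
    where open ≤-Reasoning

-- Subgraphs of large minimum degree.

module MinimumDegree {V : Set} (_≟_ : DecidableEquality V) where

  Incident : V → V × V → Set
  Incident v (a , b) = a ≡ v ⊎ b ≡ v

  incident? : ∀ v → Decidable (Incident v)
  incident? v (a , b) = (a ≟ v) ⊎-dec (b ≟ v)

  deg : List (V × V) → V → ℕ
  deg es v = length (filter (incident? v) es)

  -- No vertex set is kept: degrees are constrained only at ends of edges, so vertices that become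
  -- isolated drop out by themselves.
  record Core (m : ℕ) (es : List (V × V)) : Set where
    field
      edges    : List (V × V)
      unique   : Unique edges
      edges⊆   : edges ⊆ es
      nonempty : 0 < length edges
      degrees  : ∀ {e v} → e ∈ edges → Incident v e → m < deg edges v

  Core-mono : ∀ {m es fs} → es ⊆ fs → Core m es → Core m fs
  Core-mono es⊆fs c = record
    { edges    = edges
    ; unique   = unique
    ; edges⊆   = λ e∈ → es⊆fs (edges⊆ e∈)
    ; nonempty = nonempty
    ; degrees  = degrees
    }
    where open Core c

  -- Repeatedly delete a vertex of degree at most m: this preserves the average
  -- degree condition length vs * m ≤ length es.
  core : ∀ {m} → 1 ≤ m → ∀ n (vs : List V) (es : List (V × V)) → length vs ≤ n →
         Unique es → (∀ {e v} → e ∈ es → Incident v e → v ∈ vs) →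
         (∀ {v} → (v , v) ∉ es) → 0 < length es → length vs * m ≤ length es →
         Core m es
  -- `n` bounds the number of vertices; at zero an edge would have an end in the empty list.
  core m≥1 zero [] (e ∷ es) _ _ ends _ _ _ with () ← ends (here refl) (inj₁ refl)
  core {m} m≥1 (suc n) vs es len≤ unique ends loopless nonempty dense
    with any? (λ v → deg es v ≤? m) vs
  ... | no none = record
    { edges    = es
    ; unique   = unique
    ; edges⊆   = λ e∈ → e∈
    ; nonempty = nonempty
    ; degrees  = λ e∈ inc → ≰⇒> λ deg≤ → none (Any.map (λ { refl → deg≤ }) (ends e∈ inc))
    }
  ... | yes some
    with v , v∈ , deg≤ ← find some =
    Core-mono es′⊆
      (core m≥1 n vs′ es′ (≤-pred (≤-trans fewer len≤)) (Unique.filter⁺ _ unique)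
            ends′ (λ l∈ → loopless (es′⊆ l∈)) nonempty′ dense′)
    where
    vs′ = filter (λ u → ¬? (u ≟ v)) vs
    es′ = filter (λ e → ¬? (incident? v e)) es

    es′⊆ : es′ ⊆ es
    es′⊆ e∈ = proj₁ (∈-filter⁻ (λ e → ¬? (incident? v e)) e∈)

    fewer : length vs′ < length vs
    fewer = filter-notAll (λ u → ¬? (u ≟ v)) vs (Any.map (λ { refl ¬refl → ¬refl refl }) v∈)

    ends′ : ∀ {e u} → e ∈ es′ → Incident u e → u ∈ vs′
    ends′ e∈ inc with ∈-filter⁻ (λ e → ¬? (incident? v e)) {xs = es} e∈
    ... | e∈es , ¬inc = ∈-filter⁺ (λ u → ¬? (u ≟ v)) (ends e∈es inc) (λ { refl → ¬inc inc })

    -- The vertex side loses at least `m`, the edge side at most `m`.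
    dense′ : length vs′ * m ≤ length es′
    dense′ = +-cancelˡ-≤ m _ _ (begin
      m + length vs′ * m    ≤⟨ *-monoˡ-≤ m fewer ⟩
      length vs * m         ≤⟨ dense ⟩
      length es             ≡⟨ length-partition (incident? v) es ⟨
      deg es v + length es′ ≤⟨ +-monoˡ-≤ _ deg≤ ⟩
      m + length es′        ∎)
      where open ≤-Reasoning

    two : ∀ {es} → (∀ {e v} → e ∈ es → Incident v e → v ∈ vs) →
          (∀ {v} → (v , v) ∉ es) → 0 < length es → 2 ≤ length vs
    two {(a , b) ∷ _} ends loopless _ =
      length-mono-⊆ {xs = a ∷ b ∷ []} (((λ { refl → loopless (here refl) }) ∷ []) ∷ [] ∷ []) λ where
        (here refl)         → ends (here refl) (inj₁ refl)
        (there (here refl)) → ends (here refl) (inj₂ refl)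

    -- The two ends of an edge force, by density, at least `2 * m` edges, and at most `m` of them
    -- are deleted.
    nonempty′ : 0 < length es′
    nonempty′ = +-cancelˡ-< m _ _ (begin-strict
      m + 0                 ≡⟨ +-identityʳ m ⟩
      m                     <⟨ m<m+n m m≥1 ⟩
      m + m                 ≡⟨ cong (m +_) (+-identityʳ m) ⟨
      2 * m                 ≤⟨ *-monoˡ-≤ m (two ends loopless nonempty) ⟩
      length vs * m         ≤⟨ dense ⟩
      length es             ≡⟨ length-partition (incident? v) es ⟨
      deg es v + length es′ ≤⟨ +-monoˡ-≤ _ deg≤ ⟩
      m + length es′        ∎)
      where open ≤-Reasoning

-- Simple paths, their images, and finite counting.

module _ {R : Rel A 0ℓ} where

  snoc : ∀ {u v w xs} → Path R u v xs → R v w → w ∉ xs → Path R u w (xs ∷ʳ w)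
  snoc (stop v) r w∉ = step r (λ { (here refl) → w∉ (here refl) }) (stop _)
  snoc {w = w} (step {u} {xs = xs} s u∉ p) r w∉ =
    step s u∉′ (snoc p r (λ w∈ → w∉ (there w∈)))
    where
    u∉′ : u ∉ xs ∷ʳ w
    u∉′ u∈ with ∈-++⁻ xs u∈
    ... | inj₁ u∈xs        = u∉ u∈xs
    ... | inj₂ (here refl) = w∉ (here refl)

  path-unique : ∀ {u v xs} → Path R u v xs → Unique xs
  path-unique (stop _)      = [] ∷ []
  path-unique (step _ u∉ p) = All.¬Any⇒All¬ _ u∉ ∷ path-unique p

  path-step : ∀ {u v x xs} → Path R u v (x ∷ xs) →
              ∀ i → R (lookup (x ∷ xs) (inject₁ i)) (lookup xs i)
  path-step (step r _ (stop _))       zero    = r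
  path-step (step r _ (step _ _ _))   zero    = r
  path-step (step _ _ p@(step _ _ _)) (suc i) = path-step p i

  path-last : ∀ {u v x xs} → Path R u v (x ∷ xs) → lookup (x ∷ xs) (fromℕ (length xs)) ≡ v
  path-last (stop _)                   = refl
  path-last (step _ _ p@(stop _))     = refl
  path-last (step _ _ p@(step _ _ _)) = path-last p

  -- Relative to `S`, since a partial embedding of the tree is controlled only on the vertices
  -- placed so far.
  map-path : ∀ {E : Rel B 0ℓ} {S : List A} (ψ : A → B) →
             (∀ {x y} → x ∈ S → y ∈ S → ψ x ≡ ψ y → x ≡ y) →
             (∀ {x y} → x ∈ S → y ∈ S → R x y → E (ψ x) (ψ y)) →
             ∀ {u v xs} → xs ⊆ S → Path R u v xs → Path E (ψ u) (ψ v) (map ψ xs)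
  map-path ψ inj hom xs⊆ (stop v) = stop (ψ v)
  map-path ψ inj hom xs⊆ (step {u} {x} {xs = xs} r u∉ p) =
    step (hom (xs⊆ (here refl)) (xs⊆ (there (source∈ p))) r) ψu∉
         (map-path ψ inj hom (λ x∈ → xs⊆ (there x∈)) p)
    where
    ψu∉ : ψ u ∉ map ψ xs
    ψu∉ ψu∈ with y , y∈ , eq ← ∈-map⁻ ψ ψu∈
            with refl ← inj (xs⊆ (here refl)) (xs⊆ (there y∈)) eq = u∉ y∈

length-allFin : ∀ n → length (allFin n) ≡ n
length-allFin n = length-tabulate {n = n} (λ i → i)

unique-length≤ : ∀ {n} {xs : List (Fin n)} → Unique xs → length xs ≤ n
unique-length≤ {n} unique =
  ≤-trans (length-mono-⊆ unique (λ {x} _ → ∈-allFin x)) (≤-reflexive (length-allFin n))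

∃-fresh : DecidableEquality A → {xs ys : List A} → Unique xs → length ys < length xs →
          ∃[ x ] x ∈ xs × x ∉ ys
∃-fresh _≟_ {xs} {ys} unique longer with any? (λ x → ¬? (x ∈? ys)) xs
  where open DecMembership _≟_ using (_∈?_)
... | yes some = find some
... | no  none = contradiction (length-mono-⊆ unique xs⊆ys) (<⇒≱ longer)
  where
  open DecMembership _≟_ using (_∈?_)
  xs⊆ys : xs ⊆ ys
  xs⊆ys x∈ = decidable-stable (_ ∈? ys) λ x∉ → none (Any.map (λ { refl → x∉ }) x∈)

degree≤Δ : ∀ G v → Graph.degree G v ≤ Δ G
degree≤Δ G v = All.lookup (xs≤max 0 (map degree (allFin order))) (∈-map⁺ degree (∈-allFin v))
  where open Graph G

-- Acyclicity and leaf orders of trees.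

module _ (T : Graph) where
  open Graph T hiding (Vertex) renaming (sym to Adj-sym)
  open DecMembership (_≟_ {order}) using (_∈?_)

  path⇒cycle : ∀ {u v a b c xs} → Path Adj u v (a ∷ b ∷ c ∷ xs) → Adj v a → Cycle T
  path⇒cycle {a = a} {b} {c} {xs} p back = record
    { k         = length xs
    ; vertex    = lookup (a ∷ b ∷ c ∷ xs)
    ; injective = lookup-injective (path-unique p) _ _
    ; step      = path-step p
    ; close     = subst (λ z → Adj z _) (sym (path-last {xs = b ∷ c ∷ xs} p)) back
    }

  -- As `x ≢ v`, there are at least three vertices including `u`, as `Cycle` requires; matching on
  -- the path exposes them.
  acyclic⇒noCycle : Acyclic T → ∀ {u x v xs} → Adj u x → u ∉ xs → Path Adj x v xs →
                    x ≢ v → ¬ Adj v u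
  acyclic⇒noCycle acyclic r u∉ (stop _)               x≢v _    = x≢v refl
  acyclic⇒noCycle acyclic r u∉ (step s x∉ (stop y))   _   back =
    acyclic (path⇒cycle (step r u∉ (step s x∉ (stop y))) back)
  acyclic⇒noCycle acyclic r u∉ (step s x∉ (step t y∉ p)) _ back =
    acyclic (path⇒cycle (step r u∉ (step s x∉ (step t y∉ p))) back)

  -- A leaf order, newest vertex first: each new vertex has exactly one neighbour among the earlier
  -- ones, its parent `p`.
  data Grown : List (Vertex T) → Set where
    root : ∀ v → Grown (v ∷ [])
    grow : ∀ {S w p} → Grown S → w ∉ S → p ∈ S → Adj w p →
           (∀ {x} → x ∈ S → Adj w x → x ≡ p) → Grown (w ∷ S)

  grown-unique : ∀ {S} → Grown S → Unique S
  grown-unique (root _)           = [] ∷ []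
  grown-unique (grow g w∉ _ _ _) = All.¬Any⇒All¬ _ w∉ ∷ grown-unique g

  -- These paths close cycles in two places: in `T`, to show that a new vertex has a single parent,
  -- and in the host graph, to show that its image is new.
  grown-path : ∀ {S u v} → Grown S → u ∈ S → v ∈ S → ∃[ xs ] Path Adj u v xs × xs ⊆ S
  grown-path (root v) (here refl) (here refl) = _ , stop v , λ x∈ → x∈
  grown-path (grow _ _ _ _ _) (here refl) (here refl) = _ , stop _ , λ { (here refl) → here refl }
  grown-path (grow g w∉ p∈ w~p _) (here refl) (there v∈)
    with _ , path , xs⊆ ← grown-path g p∈ v∈ =
    _ , step w~p (λ w∈ → w∉ (xs⊆ w∈)) path ,
    λ { (here refl) → here refl ; (there x∈) → there (xs⊆ x∈) }
  grown-path (grow g w∉ p∈ w~p _) (there u∈) (here refl)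
    with xs , path , xs⊆ ← grown-path g u∈ p∈ =
    _ , snoc path (Adj-sym w~p) (λ w∈ → w∉ (xs⊆ w∈)) , ⊆S
    where
    ⊆S : xs ∷ʳ _ ⊆ _
    ⊆S x∈ with ∈-++⁻ xs x∈
    ... | inj₁ x∈xs        = there (xs⊆ x∈xs)
    ... | inj₂ (here refl) = here refl
  grown-path (grow g _ _ _ _) (there u∈) (there v∈)
    with _ , path , xs⊆ ← grown-path g u∈ v∈ = _ , path , λ x∈ → there (xs⊆ x∈)

  boundary : ∀ {S u v} → Star Adj u v → u ∈ S → v ∉ S → ∃[ p ] ∃[ w ] p ∈ S × w ∉ S × Adj w p
  boundary ε u∈ v∉ = contradiction u∈ v∉
  boundary {S} (_◅_ {j = x} r rs) u∈ v∉ with x ∈? S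
  ... | yes x∈ = boundary rs x∈ v∉
  ... | no  x∉ = _ , _ , u∈ , x∉ , Adj-sym r

  grow-spanning : IsTree T → ∀ k {S r} → Grown S → r ∈ S → order ≤ k + length S →
                  ∃[ S ] Grown S × (∀ v → v ∈ S)
  grow-spanning tree@((_ , connected) , acyclic) k {S} {r} g r∈ enough
    with any? (λ v → ¬? (v ∈? S)) (allFin order)
  ... | no  none = S , g , λ v → decidable-stable (v ∈? S) λ v∉ →
                     none (Any.map (λ { refl → v∉ }) (∈-allFin v))
  ... | yes some with v , _ , v∉ ← find some with k
  -- `k` bounds the number of missing vertices; here `v` and `S` would give more than `order`
  -- distinct vertices.
  ...   | zero  = contradiction (unique-length≤ (All.¬Any⇒All¬ _ v∉ ∷ grown-unique g))
                                (<⇒≱ (s≤s enough))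
  ...   | suc k with p , w , p∈ , w∉ , w~p ← boundary (connected r v) r∈ v∉ =
    grow-spanning tree k (grow g w∉ p∈ w~p only) (there r∈)
                  (≤-trans enough (≤-reflexive (sym (+-suc k _))))
    where
    -- A second neighbour `x` would be joined to `p` by a path inside `S`, closing a cycle through
    -- `w`.
    only : ∀ {x} → x ∈ S → Adj w x → x ≡ p
    only {x} x∈ w~x with x ≟ p
    ... | yes x≡p = x≡p
    ... | no  x≢p with _ , path , xs⊆ ← grown-path g x∈ p∈ =
      contradiction (Adj-sym w~p)
        (acyclic⇒noCycle acyclic w~x (λ w∈ → w∉ (xs⊆ w∈)) path x≢p)

  spanning : IsTree T → ∃[ S ] Grown S × (∀ v → v ∈ S)
  spanning tree@((v , _) , _) = grow-spanning tree order (root v) (here refl) (m≤m+n _ 1)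

  -- Embedding a tree under girth and minimum degree conditions.

  module Embed {V : Set} (_≟ⱽ_ : DecidableEquality V) (E : Rel V 0ℓ) (E-sym : Symmetric E)
    (E-irrefl : ∀ {v} → ¬ E v v) (noCycle : NoCycleUpTo (suc order) E)
    (minDegree : ∀ {u v} → E u v → ∃[ ns ] Unique ns × Δ T ≤ length ns × (∀ {x} → x ∈ ns → E u x))
    where

    -- `ψ` is total but constrained only on `S`. The invariant `neighbour` makes `minDegree`
    -- applicable at every image.
    record Embedding (S : List (Vertex T)) : Set where
      field
        ψ         : Vertex T → V
        injective : ∀ {x y} → x ∈ S → y ∈ S → ψ x ≡ ψ y → x ≡ y
        hom       : ∀ {x y} → x ∈ S → y ∈ S → Adj x y → E (ψ x) (ψ y)
        neighbour : ∀ {x} → x ∈ S → ∃[ y ] E (ψ x) y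

    attach : ∀ {S w p} → Grown S → w ∉ S → p ∈ S → Adj w p → (∀ {x} → x ∈ S → Adj w x → x ≡ p) →
             Embedding S → Embedding (w ∷ S)
    attach {S} {w} {p} g w∉ p∈ w~p only embedding = record
      { ψ         = ψ′
      ; injective = injective′
      ; hom       = hom′
      ; neighbour = neighbour′
      }
      where
      open Embedding embedding

      -- All earlier neighbours of `p`, the parent of `p` included.
      siblings : List (Vertex T)
      siblings = filter (adj? p) S

      -- The new vertex `w` is one further neighbour of `p`.
      siblings<Δ : length siblings < Δ T
      siblings<Δ = ≤-trans
        (length-mono-⊆ {xs = w ∷ siblings}
           (All.¬Any⇒All¬ _ (λ w∈ → w∉ (proj₁ (∈-filter⁻ (adj? p) w∈))) ∷ Unique.filter⁺ (adj? p) (grown-unique g))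
           λ { (here refl) → ∈-filter⁺ (adj? p) (∈-allFin w) (Adj-sym w~p)
             ; {x} (there x∈) → ∈-filter⁺ (adj? p) (∈-allFin x) (proj₂ (∈-filter⁻ (adj? p) {xs = S} x∈)) })
        (degree≤Δ T p)

      fresh : ∃[ y ] E (ψ p) y × y ∉ map ψ siblings
      fresh with ns , unique , Δ≤ , ns-E ← minDegree (proj₂ (neighbour p∈))
            with y , y∈ , y∉ ← ∃-fresh _≟ⱽ_ {ys = map ψ siblings} unique
                   (≤-trans (s≤s (≤-reflexive (length-map ψ siblings))) (≤-trans siblings<Δ Δ≤))
        = y , ns-E y∈ , y∉

      y : V
      y = proj₁ fresh

      E-p-y : E (ψ p) y
      E-p-y = proj₁ (proj₂ fresh)

      -- If `ψ v` were `y`, take the path from `p` to `v`. With no edge it gives a loop at `ψ p`;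
      -- with one edge `v` is a sibling, which `y` avoids; a longer one has an image that closes a
      -- short cycle.
      ψ≢y : ∀ {v} → v ∈ S → ψ v ≢ y
      ψ≢y v∈ eq with grown-path g p∈ v∈
      ... | _ , stop _ , _ = E-irrefl (subst (E (ψ p)) (sym eq) E-p-y)
      ... | _ , step {x = x} {xs = xs} p~x p∉ path , ⊆S =
        noCycle (hom p∈ x∈ p~x) ψp∉
                (map-path ψ injective hom (λ z∈ → ⊆S (there z∈)) path)
                (λ ψx≡ψv → proj₂ (proj₂ fresh)
                   (subst (_∈ map ψ siblings) (trans ψx≡ψv eq)
                     (∈-map⁺ ψ (∈-filter⁺ (adj? p) x∈ p~x))))
                (subst (λ z → E z (ψ p)) (sym eq) (E-sym E-p-y))
                (s≤s (≤-trans (≤-reflexive (length-map ψ xs)) (unique-length≤ (path-unique path))))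
        where
        x∈ : x ∈ S
        x∈ = ⊆S (there (source∈ path))

        ψp∉ : ψ p ∉ map ψ xs
        ψp∉ ψp∈ with z , z∈ , eq′ ← ∈-map⁻ ψ ψp∈ =
          p∉ (subst (_∈ xs) (sym (injective p∈ (⊆S (there z∈)) eq′)) z∈)

      ψ′ : Vertex T → V
      ψ′ x with x ≟ w
      ... | yes _ = y
      ... | no  _ = ψ x

      ψ′-new : ψ′ w ≡ y
      ψ′-new with w ≟ w
      ... | yes _   = refl
      ... | no  w≢w = contradiction refl w≢w

      ψ′-old : ∀ {x} → x ∈ S → ψ′ x ≡ ψ x
      ψ′-old {x} x∈ with x ≟ w
      ... | yes refl = contradiction x∈ w∉
      ... | no  _    = refl

      injective′ : ∀ {a b} → a ∈ w ∷ S → b ∈ w ∷ S → ψ′ a ≡ ψ′ b → a ≡ b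
      injective′ (here refl) (here refl) _  = refl
      injective′ (here refl) (there b∈)  eq =
        contradiction (trans (sym (ψ′-old b∈)) (trans (sym eq) ψ′-new)) (ψ≢y b∈)
      injective′ (there a∈)  (here refl) eq =
        contradiction (trans (sym (ψ′-old a∈)) (trans eq ψ′-new)) (ψ≢y a∈)
      injective′ (there a∈)  (there b∈)  eq =
        injective a∈ b∈ (trans (sym (ψ′-old a∈)) (trans eq (ψ′-old b∈)))

      hom′ : ∀ {a b} → a ∈ w ∷ S → b ∈ w ∷ S → Adj a b → E (ψ′ a) (ψ′ b)
      hom′ (here refl) (here refl) r = contradiction r (irrefl refl)
      hom′ (here refl) (there b∈)  r with refl ← only b∈ r =
        subst₂ E (sym ψ′-new) (sym (ψ′-old b∈)) (E-sym E-p-y)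
      hom′ (there a∈)  (here refl) r with refl ← only a∈ (Adj-sym r) =
        subst₂ E (sym (ψ′-old a∈)) (sym ψ′-new) E-p-y
      hom′ (there a∈)  (there b∈)  r =
        subst₂ E (sym (ψ′-old a∈)) (sym (ψ′-old b∈)) (hom a∈ b∈ r)

      neighbour′ : ∀ {a} → a ∈ w ∷ S → ∃[ z ] E (ψ′ a) z
      neighbour′ (here refl) = ψ p , subst (λ z → E z (ψ p)) (sym ψ′-new) (E-sym E-p-y)
      neighbour′ (there a∈) with z , e ← neighbour a∈ = z , subst (λ t → E t z) (sym (ψ′-old a∈)) e

    embed-grown : ∀ {u v S} → E u v → Grown S → Embedding S
    embed-grown {u} {v} e (root _) = record
      { ψ         = λ _ → u
      ; injective = λ { (here refl) (here refl) _ → refl }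
      ; hom       = λ { (here refl) (here refl) r → contradiction r (irrefl refl) }
      ; neighbour = λ _ → v , e
      }
    embed-grown e (grow g w∉ p∈ w~p only) = attach g w∉ p∈ w~p only (embed-grown e g)

    embed-tree : IsTree T → ∀ {u v} → E u v →
                 Σ (Vertex T → V) λ ψ → (∀ {x y} → ψ x ≡ ψ y → x ≡ y) ×
                                        (∀ {x y} → Adj x y → E (ψ x) (ψ y))
    embed-tree tree e with _ , g , all∈ ← spanning tree =
      ψ , injective (all∈ _) (all∈ _) , hom (all∈ _) (all∈ _)
      where open Embedding (embed-grown e g)

-- Simple graphs from labelled graphs, and dense colour classes.

module _ {D : ℕ} (G : LabelledGraph D) where
  open LabelledGraph G

  toGraph : Graph
  toGraph = record
    { order  = order
    ; Adj    = Adjacent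
    ; adj?   = λ u v → Fin.any? (λ i → move i u ≟ v)
    ; sym    = Adjacent-sym
    ; irrefl = λ { refl (i , eq) → Bool.not-¬ (cong side eq) (side-move i _) }
    }

  toGraph-bipartite : Bipartite toGraph
  toGraph-bipartite = side , λ { (i , refl) eq → Bool.not-¬ (sym eq) (side-move i _) }

  Δ-toGraph : Δ toGraph ≤ D
  Δ-toGraph = max≤v⁺ z≤n (All.map⁺ {xs = allFin order} (All.tabulate λ {v} _ → degree≤ v))
    where
    open Graph toGraph using (degree; adj?)
    degree≤ : ∀ v → degree v ≤ D
    degree≤ v = ≤-trans
      (length-mono-⊆ {ys = map (λ i → move i v) (allFin D)}
        (Unique.filter⁺ (adj? v) (Unique.allFin⁺ order))
        λ x∈ → let i , eq = proj₂ (∈-filter⁻ (adj? v) {xs = allFin order} x∈) in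
               subst (_∈ _) eq (∈-map⁺ (λ i → move i v) (∈-allFin i)))
      (≤-reflexive (trans (length-map (λ i → move i v) (allFin D)) (length-allFin D)))

  lefts : List (Fin order)
  lefts = filter (λ v → side v Bool.≟ false) (allFin order)

  -- Moving along a single label injects the right side into the left.
  order≤2*lefts : Fin D → order ≤ 2 * length lefts
  order≤2*lefts i = begin
    order                        ≡⟨ length-allFin order ⟨
    length (allFin order)        ≡⟨ length-partition left? (allFin order) ⟨
    length lefts + length rights ≤⟨ +-monoʳ-≤ (length lefts) rights≤ ⟩
    length lefts + length lefts  ≡⟨ cong (length lefts +_) (+-identityʳ _) ⟨
    2 * length lefts             ∎
    where
    open ≤-Reasoning
    left? = λ v → side v Bool.≟ false
    rights = filter (λ v → ¬? (left? v)) (allFin order)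

    move-injectiveʳ : ∀ {u v} → move i u ≡ move i v → u ≡ v
    move-injectiveʳ eq = trans (sym (move-involutive i _)) (trans (cong (move i) eq) (move-involutive i _))

    rights≤ : length rights ≤ length lefts
    rights≤ = ≤-trans (≤-reflexive (sym (length-map (move i) rights)))
      (length-mono-⊆ (Unique.map⁺ move-injectiveʳ (Unique.filter⁺ _ (Unique.allFin⁺ order))) λ x∈ →
        let v , v∈ , eq = ∈-map⁻ (move i) x∈
            right       = proj₂ (∈-filter⁻ (λ v → ¬? (left? v)) {xs = allFin order} v∈)
        in ∈-filter⁺ left? (∈-allFin _)
             (trans (cong side eq) (trans (side-move i v) (cong not (Bool.¬-not right)))))

  -- `f` colours darts, pairs of a vertex and a label. Storing each edge from its `false` end avoids
  -- listing it in both directions and fixes the vertex at which its dart is taken.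
  record DenseSubgraph {s} (m : ℕ) (f : Fin order × Fin D → Fin s) : Set where
    open MinimumDegree (_≟_ {order}) using (Incident; deg; incident?)
    field
      shade    : Fin s
      edges    : List (Fin order × Fin order)
      unique   : Unique edges
      nonempty : 0 < length edges
      isEdge   : ∀ {a b} → (a , b) ∈ edges →
                 side a ≡ false × (∃[ i ] f (a , i) ≡ shade × move i a ≡ b)
      degrees  : ∀ {e v} → e ∈ edges → Incident v e → m < deg edges v

    E : Rel (Fin order) 0ℓ
    E u v = (u , v) ∈ edges ⊎ (v , u) ∈ edges

    E? : ∀ u v → Dec (E u v)
    E? u v = ((u , v) ∈? edges) ⊎-dec ((v , u) ∈? edges)
      where open DecMembership (≡-dec _≟_ _≟_) using (_∈?_)

    E⇒Adjacent : ∀ {u v} → E u v → Adjacent u v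
    E⇒Adjacent (inj₁ e∈) = let _ , i , _ , eq = isEdge e∈ in i , eq
    E⇒Adjacent (inj₂ e∈) = let _ , i , _ , eq = isEdge e∈ in Adjacent-sym (i , eq)

    E-minDegree : ∀ {u v} → E u v →
                  ∃[ ns ] Unique ns × m < length ns × (∀ {x} → x ∈ ns → E u x)
    E-minDegree {u} {v} e =
      ns , Unique.filter⁺ (E? u) (Unique.allFin⁺ order) , ≤-trans (m<deg e) deg≤ ,
      λ x∈ → proj₂ (∈-filter⁻ (E? u) {xs = allFin order} x∈)
      where
      ns = filter (E? u) (allFin order)

      m<deg : E u v → m < deg edges u
      m<deg (inj₁ e∈) = degrees e∈ (inj₁ refl)
      m<deg (inj₂ e∈) = degrees e∈ (inj₂ refl)

      -- Recovers the stored pair from the other end, as `side u` decides which coordinate is `u`.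
      -- Hence incident edges are no more numerous than neighbours.
      orient : Fin order → Fin order × Fin order
      orient x = if side u then (x , u) else (u , x)

      incident⊆ : filter (incident? u) edges ⊆ map orient ns
      incident⊆ {a , b} e∈ with ∈-filter⁻ (incident? u) {xs = edges} e∈
      ... | e∈es , inj₁ refl = subst (_∈ map orient ns)
              (cong (λ t → if t then (b , u) else (u , b)) (proj₁ (isEdge e∈es)))
              (∈-map⁺ orient (∈-filter⁺ (E? u) (∈-allFin b) (inj₁ e∈es)))
      ... | e∈es , inj₂ refl = subst (_∈ map orient ns)
              (cong (λ t → if t then (a , u) else (u , a)) right)
              (∈-map⁺ orient (∈-filter⁺ (E? u) (∈-allFin a) (inj₂ e∈es)))
        where
        right : side b ≡ true
        right with left , i , _ , refl ← isEdge e∈es = trans (side-move i a) (cong not left)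

      deg≤ : deg edges u ≤ length ns
      deg≤ = ≤-trans (length-mono-⊆ (Unique.filter⁺ (incident? u) unique) incident⊆)
                     (≤-reflexive (length-map orient ns))

    ∃-E : ∃[ u ] ∃[ v ] E u v
    ∃-E = first edges nonempty (λ e∈ → e∈)
      where
      first : ∀ es → 0 < length es → es ⊆ edges → ∃[ u ] ∃[ v ] E u v
      first (_ ∷ _) _ ⊆edges = _ , _ , inj₁ (⊆edges (here refl))

  denseSubgraph : ∀ {s m n} → 1 ≤ s → 1 ≤ m → D ≡ 2 * s * m → NoClosedWordUpTo (2 + n) →
                  Fin order → (f : Fin order × Fin D → Fin s) → DenseSubgraph m f
  denseSubgraph {s} {m} {n} 1≤s 1≤m D≡ girth v₀ f = fromPopular popular
    where
    label₀ : Fin D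
    label₀ = subst Fin (sym D≡) (positive (*-mono-≤ (*-mono-≤ (s≤s (z≤n {1})) 1≤s) 1≤m))
      where
      positive : ∀ {k} → 1 ≤ k → Fin k
      positive (s≤s _) = zero

    darts : List (Fin order × Fin D)
    darts = cartesianProduct lefts (allFin D)

    darts-unique : Unique darts
    darts-unique = Unique.cartesianProduct⁺ (Unique.filter⁺ _ (Unique.allFin⁺ order)) (Unique.allFin⁺ D)

    toEdge : Fin order × Fin D → Fin order × Fin order
    toEdge (v , i) = v , move i v

    -- The girth excludes parallel edges, so counting darts at left vertices counts edges.
    toEdge-injective : ∀ {d d′} → toEdge d ≡ toEdge d′ → d ≡ d′
    toEdge-injective eq with refl , eq′ ← ,-injective eq = cong (_ ,_) (move-injectiveˡ girth eq′)

    -- At least half of the vertices are left, each with `2 * s * m` darts.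
    many : s * (order * m) ≤ length darts
    many = begin
      s * (order * m)                   ≤⟨ *-monoʳ-≤ s (*-monoˡ-≤ m (order≤2*lefts label₀)) ⟩
      s * (2 * length lefts * m)        ≡⟨ rearrange s (length lefts) m ⟩
      length lefts * (2 * s * m)        ≡⟨ cong (length lefts *_) D≡ ⟨
      length lefts * D                  ≡⟨ cong (length lefts *_) (length-allFin D) ⟨
      length lefts * length (allFin D)  ≡⟨ length-cartesianProduct lefts (allFin D) ⟨
      length darts                      ∎
      where
      open ≤-Reasoning
      open +-*-Solver
      rearrange : ∀ s l m → s * (2 * l * m) ≡ l * (2 * s * m)
      rearrange = solve 3 (λ s l m → s :* (con 2 :* l :* m) := l :* (con 2 :* s :* m)) refl

    shaded : Fin s → List (Fin order × Fin D)
    shaded c = filter (λ d → f d ≟ c) darts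

    popular : ∃[ c ] order * m ≤ length (shaded c) × 0 < length (shaded c)
    popular = large (order * m) (*-mono-≤ (nonempty v₀) 1≤m) many
      where
      nonempty : ∀ {k} → Fin k → 1 ≤ k
      nonempty {suc _} _ = s≤s z≤n

      -- `pigeonhole` needs strictly more darts than `s` times its threshold and returns a strict
      -- bound, so it is applied to the predecessor of `order * m`.
      large : ∀ q → 1 ≤ q → s * q ≤ length darts →
              ∃[ c ] q ≤ length (shaded c) × 0 < length (shaded c)
      large (suc q) _ ≤darts with c , q< ← pigeonhole _≟_ f q (allFin s) darts (λ _ → ∈-allFin _)
        (<-≤-trans (subst (λ k → k * q < s * suc q) (sym (length-allFin s))
                     (*-monoʳ-< s {{>-nonZero 1≤s}} (n<1+n q))) ≤darts)
        = c , q< , ≤-trans (s≤s z≤n) q<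

    toEdge-left : ∀ c {a b} → (a , b) ∈ map toEdge (shaded c) →
                  side a ≡ false × (∃[ i ] f (a , i) ≡ c × move i a ≡ b)
    toEdge-left c e∈ with (a , i) , d∈ , refl ← ∈-map⁻ toEdge e∈
      with d∈darts , f≡c ← ∈-filter⁻ (λ d → f d ≟ c) {xs = darts} d∈
      with a∈ , _ ← ∈-cartesianProduct⁻ lefts (allFin D) d∈darts =
      proj₂ (∈-filter⁻ (λ v → side v Bool.≟ false) {xs = allFin order} a∈) , i , f≡c , refl

    fromCore : ∀ c → MinimumDegree.Core _≟_ m (map toEdge (shaded c)) → DenseSubgraph m f
    fromCore c core = record
      { shade    = c
      ; edges    = edges
      ; unique   = unique
      ; nonempty = nonempty
      ; isEdge   = λ e∈ → toEdge-left c (edges⊆ e∈)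
      ; degrees  = degrees
      }
      where open MinimumDegree.Core core

    fromPopular : ∃[ c ] order * m ≤ length (shaded c) × 0 < length (shaded c) → DenseSubgraph m f
    fromPopular (c , dense , nonempty) = fromCore c
      (MinimumDegree.core _≟_ 1≤m order (allFin order) (map toEdge (shaded c))
        (≤-reflexive (length-allFin order))
        (Unique.map⁺ toEdge-injective (Unique.filter⁺ (λ d → f d ≟ c) darts-unique))
        (λ _ _ → ∈-allFin _)
        (λ l∈ → let _ , i , _ , eq = toEdge-left c l∈ in
                Bool.not-¬ (cong side eq) (side-move i _))
        (subst (0 <_) (sym (length-map toEdge (shaded c))) nonempty)
        (subst₂ _≤_ (cong (_* m) (sym (length-allFin order)))
                    (sym (length-map toEdge (shaded c))) dense))

-- The Ramsey property and the degree bound.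

NoCycleUpTo-⊆ : ∀ {n} {R E : Rel A 0ℓ} → (∀ {u v} → E u v → R u v) →
                 NoCycleUpTo n R → NoCycleUpTo n E
NoCycleUpTo-⊆ {R = R} {E} E⊆R noCycle e u∉ p x≢v back = noCycle (E⊆R e) u∉ (weaken p) x≢v (E⊆R back)
  where
  weaken : ∀ {u v xs} → Path E u v xs → Path R u v xs
  weaken (stop v)      = stop v
  weaken (step r u∉ p) = step (E⊆R r) u∉ (weaken p)

-- The girth bound serves twice: it excludes parallel edges, and it excludes the cycles that the
-- embedding of `T` could close.
ramsey : ∀ {s D m} T → IsTree T → 1 ≤ s → 1 ≤ m → Δ T ≤ suc m → D ≡ 2 * s * m →
         (G : LabelledGraph D) → LabelledGraph.NoClosedWordUpTo G (2 + Graph.order T) →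
         Fin (LabelledGraph.order G) → toGraph G ⟶[ s ] T
ramsey {s} {m = m} T tree 1≤s 1≤m Δ≤ D≡ G girth v₀ χ =
  fromDense (denseSubgraph G {n = Graph.order T} 1≤s 1≤m D≡ girth v₀ dartColour)
  where
  open LabelledGraph G
  open EdgeColouring χ

  dartColour : Fin order × Fin _ → Fin s
  dartColour (v , i) = colour {v} (i , refl)

  fromDense : DenseSubgraph G m dartColour → MonochromaticCopy T (toGraph G) χ
  fromDense dense = record
    { embed     = proj₁ copy
    ; injective = proj₁ (proj₂ copy)
    ; edge      = λ r → E⇒Adjacent (proj₂ (proj₂ copy) r)
    ; shade     = shade
    ; mono      = λ r → E-colour (proj₂ (proj₂ copy) r) _
    }
    where
    open DenseSubgraph dense

    -- `colour` takes a proof of adjacency; comparing with a proof for the reversed edge shows that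
    -- all proofs give the colour of the stored dart.
    E-colour : ∀ {u v} → E u v → (r : Adjacent u v) → colour r ≡ shade
    E-colour (inj₁ e∈) r with _ , i , eq , refl ← isEdge e∈ =
      trans (colour-sym r (Adjacent-sym r)) (trans (sym (colour-sym (i , refl) (Adjacent-sym r))) eq)
    E-colour (inj₂ e∈) r with _ , i , eq , refl ← isEdge e∈ = trans (colour-sym r (i , refl)) eq

    copy : Σ (Vertex T → Fin order) λ ψ → (∀ {x y} → ψ x ≡ ψ y → x ≡ y) ×
                                          (∀ {x y} → Graph.Adj T x y → E (ψ x) (ψ y))
    copy = embed-tree tree (proj₂ (proj₂ ∃-E))
      where
      E-irrefl : ∀ {v} → ¬ E v v
      E-irrefl e = Graph.irrefl (toGraph G) refl (E⇒Adjacent e)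

      E-noCycle : NoCycleUpTo (suc (Graph.order T)) E
      E-noCycle = NoCycleUpTo-⊆ E⇒Adjacent λ r u∉ p x≢v back short →
        noCycleUpTo girth r u∉ p x≢v back (<-trans short (n<1+n _))

      minDegree : ∀ {u v} → E u v →
                  ∃[ ns ] Unique ns × Δ T ≤ length ns × (∀ {x} → x ∈ ns → E u x)
      minDegree e with ns , unique-ns , m< , ns-E ← E-minDegree e =
        ns , unique-ns , ≤-trans Δ≤ m< , ns-E

      open Embed T _≟_ E swap E-irrefl E-noCycle minDegree

-- If no minimum up to `n` existed, then by strong induction no smaller number would satisfy `P`,
-- and `n` itself would be the minimum.
∃-minimum : ∀ {ℓ} (P : ℕ → Set ℓ) n → P n → ¬ ¬ (∃[ d ] IsMinimum P d × d ≤ n)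
∃-minimum P = <-rec _ λ n rec pn none →
  none (n , (pn , λ k pk → ≮⇒≥ λ k<n →
    rec k<n pk λ (d , min , d≤k) → none (d , min , ≤-trans d≤k (<⇒≤ k<n))) , ≤-refl)

theorem2 : (s : ℕ) → 1 ≤ s → (T : Graph) → IsTree T → 2 ≤ Δ T →
    (∃[ H ] Bipartite H × H ⟶[ s ] T × Δ H ≤ 2 * s * (Δ T ∸ 1))
    × ¬ ¬ (∃[ d ] IsBrΔ T s d × d ≤ 2 * s * (Δ T ∸ 1))
theorem2 s 1≤s T tree 2≤Δ
  with G , girth , v₀ ← highGirth (2 * s * (Δ T ∸ 1)) (2 + Graph.order T) =
  (H , toGraph-bipartite G , H⟶T , Δ-toGraph G) ,
  λ none → ∃-minimum (BipartiteRamseyDegree T s) (Δ H) (H , toGraph-bipartite G , H⟶T , refl)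
    λ (d , min , d≤) → none (d , min , ≤-trans d≤ (Δ-toGraph G))
  where
  H : Graph
  H = toGraph G

  H⟶T : H ⟶[ s ] T
  H⟶T = ramsey T tree 1≤s (∸-monoˡ-≤ 1 2≤Δ)
    (≤-reflexive (sym (m+[n∸m]≡n (≤-trans (s≤s z≤n) 2≤Δ)))) refl G girth v₀
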